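{- Let $m\in\mathbb{N}$, $r\ge0$, and let $\lambda$ be a nonzero real number. For all integers $l,n\ge0$, \[ D^{(r)}_{m,\lambda}(l+n,x)=\sum_{j=0}^{l}\sum_{k=0}^{n}\binom{n}{k}W^{(r)}_{m,\lambda}(l,j)\,x^{j}\,(mj-l\lambda)_{n-k,\lambda}\,D^{(r)}_{m,\lambda}(k,x) \] as polynomials in $x$; equivalently, with $a^{+}$ the boson creation operator, \[ D^{(r)}_{m,\lambda}(l+n,m a^{+})=\sum_{j=0}^{l}\sum_{k=0}^{n}\binom{n}{k}W^{(r)}_{m,\lambda}(l,j)\,m^{j}(a^{+})^{j}(mj-l\lambda)_{n-k,\lambda}D^{(r)}_{m,\lambda}(k,m a^{+}). \]
   Context: $(x)_{0,\lambda}=1$ and $(x)_{n,\lambda}=x(x-\lambda)\cdots(x-(n-1)\lambda)$ for $n\ge1$; $(x)_k=x(x-1)\cdots(x-k+1)$. For $m\in\mathbb{N}$ and $r\ge0$, the degenerate $r$-Whitney numbers of the second kind $W^{(r)}_{m,\lambda}(n,k)$ are defined by $(mx+r)_{n,\lambda}=\sum_{k=0}^{n}W^{(r)}_{m,\lambda}(n,k)m^{k}(x)_k$ ($n\ge0$), and the degenerate $r$-Dowling polynomials are $D^{(r)}_{m,\lambda}(n,x)=\sum_{k=0}^{n}W^{(r)}_{m,\lambda}(n,k)x^{k}$. -}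

module Defs where

open import Level using (Level; _⊔_; 0ℓ) renaming (suc to lsuc)
open import Algebra.Bundles using (CommutativeRing; Ring; Semiring)
open import Algebra.Morphism.Structures using (IsRingHomomorphism)
open import Data.Product using (_,_; proj₁; proj₂; ∃-syntax) renaming (_×_ to _∧_)
import Relation.Binary.PropositionalEquality as ≡
open ≡ using (_≡_)

-- The real numbers, as Cauchy sequences of rationals.  Close x x says
-- that x is a Cauchy sequence, and for Cauchy sequences Close x y says
-- that x - y tends to 0.
module Real where

  open import Data.Nat as ℕ using (ℕ)
  import Data.Nat.Properties as ℕ
  open import Data.Rational
  open import Data.Rational.Properties
  open import Data.Rational.Solver
  open +-*-Solver

  Close : (ℕ → ℚ) → (ℕ → ℚ) → Set
  Close x y = ∀ ε → 0ℚ < ε →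
    ∃[ N ] ∀ i j → N ℕ.≤ i → N ℕ.≤ j → ∣ x i - y j ∣ < ε

  record ℝ : Set where
    no-eta-equality; constructor mkℝ
    field
      seq    : ℕ → ℚ
      cauchy : Close seq seq
  open ℝ public

  infix 4 _≈ᴿ_ _≤ᴿ_

  -- A record, so that x and y can be inferred from x ≈ᴿ y.
  record _≈ᴿ_ (x y : ℝ) : Set where
    no-eta-equality; constructor mk≈
    field close : Close (seq x) (seq y)
  open _≈ᴿ_ public

  _≤ᴿ_ : ℝ → ℝ → Set
  x ≤ᴿ y = ∀ ε → 0ℚ < ε → ∃[ N ] ∀ i → N ℕ.≤ i → seq x i - seq y i < ε

  private
    -‿swap : ∀ p q → - (p - q) ≡ q - p
    -‿swap = solve 2 (λ p q → :- (p :- q) := q :- p) ≡.refl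

    sub-trans : ∀ p q r → (p - q) + (q - r) ≡ p - r
    sub-trans = solve 3 (λ p q r → (p :- q) :+ (q :- r) := p :- r) ≡.refl

    sub-+ : ∀ p q r s → (p - q) + (r - s) ≡ (p + r) - (q + s)
    sub-+ = solve 4 (λ p q r s → (p :- q) :+ (r :- s) := (p :+ r) :- (q :+ s)) ≡.refl

    sub-neg : ∀ p q → q - p ≡ - p - - q
    sub-neg = solve 2 (λ p q → q :- p := :- p :- :- q) ≡.refl

    sub-* : ∀ p q r s → p * (r - s) + s * (p - q) ≡ p * r - q * s
    sub-* = solve 4 (λ p q r s → p :* (r :- s) :+ s :* (p :- q) := p :* r :- q :* s) ≡.refl

    sub-add : ∀ p q → (p - q) + q ≡ p
    sub-add = solve 2 (λ p q → (p :- q) :+ q := p) ≡.refl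

    half : ∀ {ε} → 0ℚ < ε → 0ℚ < ½ * ε
    half {ε} p = ≡.subst (_< ½ * ε) (*-zeroʳ ½) (*-monoʳ-<-pos ½ p)

    halves : ∀ ε → ½ * ε + ½ * ε ≡ ε
    halves ε = ≡.trans (≡.sym (*-distribʳ-+ ε ½ ½)) (*-identityˡ ε)

    swap : ∀ p q → ∣ p - q ∣ ≡ ∣ q - p ∣
    swap p q = ≡.trans (≡.sym (∣-p∣≡∣p∣ (p - q)))
      (≡.cong ∣_∣ (-‿swap p q))

    triangle : ∀ {p q δ ε} → ∣ p ∣ < δ → ∣ q ∣ < ε → ∣ p + q ∣ < δ + ε
    triangle {p} {q} a b = ≤-<-trans (∣p+q∣≤∣p∣+∣q∣ p q) (+-mono-< a b)

    triangle½ : ∀ {p q s} ε → ∣ p ∣ < ½ * ε → ∣ q ∣ < ½ * ε → p + q ≡ s → ∣ s ∣ < ε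
    triangle½ ε a b ≡.refl = ≡.subst (_ <_) (halves ε) (triangle a b)

    ⊔ˡ : ∀ {M N i} → M ℕ.⊔ N ℕ.≤ i → M ℕ.≤ i
    ⊔ˡ {M} {N} = ℕ.m⊔n≤o⇒m≤o M N

    ⊔ʳ : ∀ {M N i} → M ℕ.⊔ N ℕ.≤ i → N ℕ.≤ i
    ⊔ʳ {M} {N} = ℕ.m⊔n≤o⇒n≤o M N

    symᶜ : ∀ {x y} → Close x y → Close y x
    symᶜ {x} {y} c ε ε>0 with c ε ε>0
    ... | N , h = N , λ i j Ni Nj → ≡.subst (_< ε) (swap (x j) (y i)) (h j i Nj Ni)

    transᶜ : ∀ {x y z} → Close x y → Close y z → Close x z
    transᶜ {x} {y} {z} c d ε ε>0 with c (½ * ε) (half ε>0) | d (½ * ε) (half ε>0)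
    ... | M , g | N , h = M ℕ.⊔ N , λ i j p q →
      triangle½ ε (g i (M ℕ.⊔ N) (⊔ˡ p) (ℕ.m≤m⊔n M N)) (h (M ℕ.⊔ N) j (ℕ.m≤n⊔m M N) (⊔ʳ {M} q))
        (sub-trans (x i) (y (M ℕ.⊔ N)) (z j))

    +ᶜ : ∀ {x y u v} → Close x y → Close u v → Close (λ i → x i + u i) (λ i → y i + v i)
    +ᶜ {x} {y} {u} {v} c d ε ε>0 with c (½ * ε) (half ε>0) | d (½ * ε) (half ε>0)
    ... | M , g | N , h = M ℕ.⊔ N , λ i j p q →
      triangle½ ε (g i j (⊔ˡ p) (⊔ˡ q)) (h i j (⊔ʳ {M} p) (⊔ʳ {M} q))
        (sub-+ (x i) (y j) (u i) (v j))

    -ᶜ : ∀ {x y} → Close x y → Close (λ i → - x i) (λ i → - y i)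
    -ᶜ {x} {y} c ε ε>0 with c ε ε>0
    ... | N , h = N , λ i j p q → ≡.subst (_< ε)
      (≡.trans (swap (x i) (y j)) (≡.cong ∣_∣
        (sub-neg (x i) (y j)))) (h i j p q)

    1>0 : 0ℚ < 1ℚ
    1>0 = positive⁻¹ 1ℚ

    bounded : ∀ {x y} → Close x y →
      ∃[ B ] ∃[ N ] 0ℚ < B ∧ (∀ i → N ℕ.≤ i → ∣ x i ∣ < B)
    bounded {x} {y} c with c 1ℚ 1>0
    ... | N , h = 1ℚ + ∣ y N ∣ , N , +-mono-<-≤ 1>0 (0≤∣p∣ (y N)) , λ i p →
      ≡.subst (λ z → ∣ z ∣ < 1ℚ + ∣ y N ∣)
        (sub-add (x i) (y N))
        (≤-<-trans (∣p+q∣≤∣p∣+∣q∣ (x i - y N) (y N))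
          (+-monoˡ-< ∣ y N ∣ (h i N p ℕ.≤-refl)))

    quotient : ∀ B ε → 0ℚ < B → 0ℚ < ε → ∃[ δ ] 0ℚ < δ ∧ B * δ ≡ ε
    quotient B ε B>0 ε>0 = (1/ B) * ε
      , ≡.subst (_< (1/ B) * ε) (*-zeroʳ (1/ B)) (*-monoʳ-<-pos (1/ B) ε>0)
      , ≡.trans (≡.sym (*-assoc B (1/ B) ε))
          (≡.trans (≡.cong (_* ε) (*-inverseʳ B)) (*-identityˡ ε))
      where
      instance
        B⁺ = positive B>0
        B≢0 = pos⇒nonZero B
        1/B⁺ = 1/pos⇒pos B

    product : ∀ {B δ} p q → 0ℚ < B → ∣ p ∣ < B → ∣ q ∣ < δ → ∣ p * q ∣ < B * δ
    product {B} {δ} p q B>0 a b = ≤-<-trans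
      (≡.subst (_≤ B * ∣ q ∣) (≡.sym (∣p*q∣≡∣p∣*∣q∣ p q))
        (*-monoʳ-≤-nonNeg ∣ q ∣ (<⇒≤ a)))
      (*-monoʳ-<-pos B b)
      where
      instance
        B⁺ = positive B>0
        q⁺ = ∣-∣-nonNeg q

    *-lemma : ∀ ε {B C δ γ} p q r s → 0ℚ < B → 0ℚ < C → B * δ ≡ ½ * ε → C * γ ≡ ½ * ε →
      ∣ p ∣ < B → ∣ s ∣ < C → ∣ r - s ∣ < δ → ∣ p - q ∣ < γ → ∣ p * r - q * s ∣ < ε
    *-lemma ε p q r s B>0 C>0 Bδ Cγ p<B s<C r-s<δ p-q<γ = triangle½ ε
      (≡.subst (∣ p * (r - s) ∣ <_) Bδ (product p (r - s) B>0 p<B r-s<δ))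
      (≡.subst (∣ s * (p - q) ∣ <_) Cγ (product s (p - q) C>0 s<C p-q<γ))
      (sub-* p q r s)

    *ᶜ : ∀ {x y u v} → Close x y → Close u v → Close (λ i → x i * u i) (λ i → y i * v i)
    *ᶜ {x} {y} {u} {v} c d ε ε>0 =
      let B , K , B>0 , x<B = bounded {x} {y} c
          C , L , C>0 , v<C = bounded {v} {u} (symᶜ {u} {v} d)
          δ , δ>0 , Bδ = quotient B (½ * ε) B>0 (half ε>0)
          γ , γ>0 , Cγ = quotient C (½ * ε) C>0 (half ε>0)
          M , g = d δ δ>0
          N , h = c γ γ>0
      in (K ℕ.⊔ L) ℕ.⊔ (M ℕ.⊔ N) , λ i j p q →
        *-lemma ε (x i) (y j) (u i) (v j) B>0 C>0 Bδ Cγ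
          (x<B i (⊔ˡ (⊔ˡ p))) (v<C j (⊔ʳ {K} (⊔ˡ q)))
          (g i j (⊔ˡ (⊔ʳ {K ℕ.⊔ L} p)) (⊔ˡ (⊔ʳ {K ℕ.⊔ L} q)))
          (h i j (⊔ʳ {M} (⊔ʳ {K ℕ.⊔ L} p)) (⊔ʳ {M} (⊔ʳ {K ℕ.⊔ L} q)))

    pointwise : ∀ (x y : ℝ) → (∀ i → seq x i ≡ seq y i) → x ≈ᴿ y
    pointwise x y e .close ε ε>0 with cauchy x ε ε>0
    ... | N , h = N , λ i j p q → ≡.subst (λ z → ∣ seq x i - z ∣ < ε) (e j) (h i j p q)

  fromℚ : ℚ → ℝ
  fromℚ q = mkℝ (λ _ → q) λ ε ε>0 → 0 , λ _ _ _ _ →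
    ≡.subst (λ z → ∣ z ∣ < ε) (≡.sym (+-inverseʳ q)) ε>0

  infixl 6 _+ᴿ_
  infixl 7 _*ᴿ_
  infix  8 negᴿ_

  _+ᴿ_ _*ᴿ_ : ℝ → ℝ → ℝ
  (x +ᴿ y) .seq i  = seq x i + seq y i
  (x +ᴿ y) .cauchy = +ᶜ {seq x} {seq x} {seq y} {seq y} (cauchy x) (cauchy y)
  (x *ᴿ y) .seq i  = seq x i * seq y i
  (x *ᴿ y) .cauchy = *ᶜ {seq x} {seq x} {seq y} {seq y} (cauchy x) (cauchy y)

  negᴿ_ : ℝ → ℝ
  (negᴿ x) .seq i  = - seq x i
  (negᴿ x) .cauchy = -ᶜ {seq x} {seq x} (cauchy x)

  0ᴿ 1ᴿ : ℝ
  0ᴿ = fromℚ 0ℚ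
  1ᴿ = fromℚ 1ℚ

  private
    sym : ∀ {x y} → x ≈ᴿ y → y ≈ᴿ x
    sym {x} {y} p .close = symᶜ {seq x} {seq y} (close p)

    trans : ∀ {x y z} → x ≈ᴿ y → y ≈ᴿ z → x ≈ᴿ z
    trans {x} {y} {z} p q .close = transᶜ {seq x} {seq y} {seq z} (close p) (close q)

    +-congᴿ : ∀ {x y u v} → x ≈ᴿ y → u ≈ᴿ v → x +ᴿ u ≈ᴿ y +ᴿ v
    +-congᴿ {x} {y} {u} {v} p q .close = +ᶜ {seq x} {seq y} {seq u} {seq v} (close p) (close q)

    *-congᴿ : ∀ {x y u v} → x ≈ᴿ y → u ≈ᴿ v → x *ᴿ u ≈ᴿ y *ᴿ v
    *-congᴿ {x} {y} {u} {v} p q .close = *ᶜ {seq x} {seq y} {seq u} {seq v} (close p) (close q)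

    -‿congᴿ : ∀ {x y} → x ≈ᴿ y → negᴿ x ≈ᴿ negᴿ y
    -‿congᴿ {x} {y} p .close = -ᶜ {seq x} {seq y} (close p)

    +-assocᴿ : ∀ x y z → (x +ᴿ y) +ᴿ z ≈ᴿ x +ᴿ (y +ᴿ z)
    +-assocᴿ x y z = pointwise ((x +ᴿ y) +ᴿ z) (x +ᴿ (y +ᴿ z)) λ i →
      +-assoc (seq x i) (seq y i) (seq z i)

    +-commᴿ : ∀ x y → x +ᴿ y ≈ᴿ y +ᴿ x
    +-commᴿ x y = pointwise (x +ᴿ y) (y +ᴿ x) λ i →
      +-comm (seq x i) (seq y i)

    +-identityˡᴿ : ∀ x → 0ᴿ +ᴿ x ≈ᴿ x
    +-identityˡᴿ x = pointwise (0ᴿ +ᴿ x) (x) λ i →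
      +-identityˡ (seq x i)

    +-identityʳᴿ : ∀ x → x +ᴿ 0ᴿ ≈ᴿ x
    +-identityʳᴿ x = pointwise (x +ᴿ 0ᴿ) (x) λ i →
      +-identityʳ (seq x i)

    +-inverseˡᴿ : ∀ x → (negᴿ x) +ᴿ x ≈ᴿ 0ᴿ
    +-inverseˡᴿ x = pointwise ((negᴿ x) +ᴿ x) (0ᴿ) λ i →
      +-inverseˡ (seq x i)

    +-inverseʳᴿ : ∀ x → x +ᴿ (negᴿ x) ≈ᴿ 0ᴿ
    +-inverseʳᴿ x = pointwise (x +ᴿ (negᴿ x)) (0ᴿ) λ i →
      +-inverseʳ (seq x i)

    *-assocᴿ : ∀ x y z → (x *ᴿ y) *ᴿ z ≈ᴿ x *ᴿ (y *ᴿ z)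
    *-assocᴿ x y z = pointwise ((x *ᴿ y) *ᴿ z) (x *ᴿ (y *ᴿ z)) λ i →
      *-assoc (seq x i) (seq y i) (seq z i)

    *-commᴿ : ∀ x y → x *ᴿ y ≈ᴿ y *ᴿ x
    *-commᴿ x y = pointwise (x *ᴿ y) (y *ᴿ x) λ i →
      *-comm (seq x i) (seq y i)

    *-identityˡᴿ : ∀ x → 1ᴿ *ᴿ x ≈ᴿ x
    *-identityˡᴿ x = pointwise (1ᴿ *ᴿ x) (x) λ i →
      *-identityˡ (seq x i)

    *-identityʳᴿ : ∀ x → x *ᴿ 1ᴿ ≈ᴿ x
    *-identityʳᴿ x = pointwise (x *ᴿ 1ᴿ) (x) λ i →
      *-identityʳ (seq x i)

    distribˡᴿ : ∀ x y z → x *ᴿ (y +ᴿ z) ≈ᴿ x *ᴿ y +ᴿ x *ᴿ z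
    distribˡᴿ x y z = pointwise (x *ᴿ (y +ᴿ z)) (x *ᴿ y +ᴿ x *ᴿ z) λ i →
      *-distribˡ-+ (seq x i) (seq y i) (seq z i)

    distribʳᴿ : ∀ x y z → (y +ᴿ z) *ᴿ x ≈ᴿ y *ᴿ x +ᴿ z *ᴿ x
    distribʳᴿ x y z = pointwise ((y +ᴿ z) *ᴿ x) (y *ᴿ x +ᴿ z *ᴿ x) λ i →
      *-distribʳ-+ (seq x i) (seq y i) (seq z i)

    reflᴿ : ∀ {x} → x ≈ᴿ x
    reflᴿ {x} .close = cauchy x

  ℝ-commutativeRing : CommutativeRing 0ℓ 0ℓ
  ℝ-commutativeRing = record
    { Carrier = ℝ ; _≈_ = _≈ᴿ_ ; _+_ = _+ᴿ_ ; _*_ = _*ᴿ_ ; -_ = negᴿ_ ; 0# = 0ᴿ ; 1# = 1ᴿ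
    ; isCommutativeRing = record
      { isRing = record
        { +-isAbelianGroup = record
          { isGroup = record
            { isMonoid = record
              { isSemigroup = record
                { isMagma = record
                  { isEquivalence = record
                    { refl  = reflᴿ
                    ; sym   = sym
                    ; trans = trans
                    }
                  ; ∙-cong = +-congᴿ
                  }
                ; assoc = +-assocᴿ
                }
              ; identity = +-identityˡᴿ , +-identityʳᴿ
              }
            ; inverse = +-inverseˡᴿ , +-inverseʳᴿ
            ; ⁻¹-cong = -‿congᴿ
            }
          ; comm = +-commᴿ
          }
        ; *-cong = *-congᴿ
        ; *-assoc = *-assocᴿ
        ; *-identity = *-identityˡᴿ , *-identityʳᴿ
        ; distrib = distribˡᴿ , distribʳᴿ
        }
      ; *-comm = *-commᴿ
      }
    }

open Real public using (ℝ; _≈ᴿ_; _≤ᴿ_; _+ᴿ_; _*ᴿ_; 0ᴿ; 1ᴿ; ℝ-commutativeRing)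
open CommutativeRing ℝ-commutativeRing public using () renaming (_-_ to infixl 6 _-ᴿ_)

open import Data.Nat using (ℕ; zero; suc; _∸_)
open import Data.Nat.Combinatorics using (_C_) public
open import Data.Fin using (toℕ)
open import Data.List using (List; []; _∷_; map)
import Algebra.Properties.Ring as RingProperties

private variable c ℓ a ℓᵃ : Level

module Summation (S : Semiring c ℓ) where

  open Semiring S
  open import Algebra.Properties.Semiring.Sum S using (sum)

  infix 6 ∑≤
  ∑≤ : ℕ → (ℕ → Carrier) → Carrier
  ∑≤ n f = sum {suc n} (λ i → f (toℕ i))

  syntax ∑≤ n (λ k → t) = ∑[ k ≤ n ] t

record Algebra (R : CommutativeRing c ℓ) (a ℓᵃ : Level) : Set (c ⊔ ℓ ⊔ lsuc (a ⊔ ℓᵃ)) where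
  private module R = CommutativeRing R
  field
    ring : Ring a ℓᵃ
  open Ring ring public
  field
    ι                    : R.Carrier → Carrier
    ι-isRingHomomorphism : IsRingHomomorphism R.rawRing rawRing ι
    ι-central            : ∀ s x → ι s * x ≈ x * ι s

  infixr 7 _·_
  _·_ : R.Carrier → Carrier → Carrier
  s · x = ι s * x

  open import Algebra.Properties.Semiring.Exp semiring public using (_^_)
  open Summation semiring public

module Polynomial (R : CommutativeRing c ℓ) where

  open CommutativeRing R
  open RingProperties ring using (-0#≈0#)
  open import Relation.Binary.Reasoning.Setoid setoid

  -- Coefficient lists, lowest degree first; trailing zeros are allowed.
  Poly : Set c
  Poly = List Carrier

  coeff : Poly → ℕ → Carrier
  coeff []      i       = 0#
  coeff (a ∷ p) zero    = a
  coeff (a ∷ p) (suc i) = coeff p i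

  infix 4 _≈ᴾ_

  record _≈ᴾ_ (p q : Poly) : Set ℓ where
    no-eta-equality; constructor mk≈
    field at : ∀ i → coeff p i ≈ coeff q i
  open _≈ᴾ_ public

  infixl 6 _+ᴾ_
  infixl 7 _*ᴾ_
  infixr 7 _∙_

  _+ᴾ_ : Poly → Poly → Poly
  []      +ᴾ q       = q
  (a ∷ p) +ᴾ []      = a ∷ p
  (a ∷ p) +ᴾ (b ∷ q) = a + b ∷ p +ᴾ q

  -ᴾ_ : Poly → Poly
  -ᴾ p = map (λ a → - a) p

  _∙_ : Carrier → Poly → Poly
  s ∙ p = map (s *_) p

  _*ᴾ_ : Poly → Poly → Poly
  []      *ᴾ q = []
  (a ∷ p) *ᴾ q = a ∙ q +ᴾ (0# ∷ p *ᴾ q)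

  constant : Carrier → Poly
  constant s = s ∷ []

  X : Poly
  X = 0# ∷ 1# ∷ []

  private
    coeff-+ : ∀ p q i → coeff (p +ᴾ q) i ≈ coeff p i + coeff q i
    coeff-+ []      q       i       = sym (+-identityˡ _)
    coeff-+ (a ∷ p) []      i       = sym (+-identityʳ _)
    coeff-+ (a ∷ p) (b ∷ q) zero    = refl
    coeff-+ (a ∷ p) (b ∷ q) (suc i) = coeff-+ p q i

    coeff-- : ∀ p i → coeff (-ᴾ p) i ≈ - coeff p i
    coeff-- []      i       = sym -0#≈0#
    coeff-- (a ∷ p) zero    = refl
    coeff-- (a ∷ p) (suc i) = coeff-- p i

    coeff-∙ : ∀ s p i → coeff (s ∙ p) i ≈ s * coeff p i
    coeff-∙ s []      i       = sym (zeroʳ s)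
    coeff-∙ s (a ∷ p) zero    = refl
    coeff-∙ s (a ∷ p) (suc i) = coeff-∙ s p i

    reflᴾ : ∀ {p} → p ≈ᴾ p
    reflᴾ .at i = refl

    symᴾ : ∀ {p q} → p ≈ᴾ q → q ≈ᴾ p
    symᴾ e .at i = sym (at e i)

    transᴾ : ∀ {p q r} → p ≈ᴾ q → q ≈ᴾ r → p ≈ᴾ r
    transᴾ e f .at i = trans (at e i) (at f i)

    +-congᴾ : ∀ {p q r s} → p ≈ᴾ q → r ≈ᴾ s → p +ᴾ r ≈ᴾ q +ᴾ s
    +-congᴾ {p} {q} {r} {s} e f .at i =
      trans (coeff-+ p r i) (trans (+-cong (at e i) (at f i)) (sym (coeff-+ q s i)))

    +-assocᴾ : ∀ p q r → (p +ᴾ q) +ᴾ r ≈ᴾ p +ᴾ (q +ᴾ r)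
    +-assocᴾ p q r .at i = begin
      coeff ((p +ᴾ q) +ᴾ r) i               ≈⟨ coeff-+ (p +ᴾ q) r i ⟩
      coeff (p +ᴾ q) i + coeff r i          ≈⟨ +-congʳ (coeff-+ p q i) ⟩
      (coeff p i + coeff q i) + coeff r i   ≈⟨ +-assoc _ _ _ ⟩
      coeff p i + (coeff q i + coeff r i)   ≈⟨ +-congˡ (coeff-+ q r i) ⟨
      coeff p i + coeff (q +ᴾ r) i          ≈⟨ coeff-+ p (q +ᴾ r) i ⟨
      coeff (p +ᴾ (q +ᴾ r)) i               ∎

    +-commᴾ : ∀ p q → p +ᴾ q ≈ᴾ q +ᴾ p
    +-commᴾ p q .at i = trans (coeff-+ p q i) (trans (+-comm _ _) (sym (coeff-+ q p i)))

    +-identityˡᴾ : ∀ p → [] +ᴾ p ≈ᴾ p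
    +-identityˡᴾ p = reflᴾ

    +-identityʳᴾ : ∀ p → p +ᴾ [] ≈ᴾ p
    +-identityʳᴾ p = transᴾ (+-commᴾ p []) reflᴾ

    +-inverseʳᴾ : ∀ p → p +ᴾ (-ᴾ p) ≈ᴾ []
    +-inverseʳᴾ p .at i =
      trans (coeff-+ p (-ᴾ p) i) (trans (+-congˡ (coeff-- p i)) (-‿inverseʳ _))

    +-inverseˡᴾ : ∀ p → (-ᴾ p) +ᴾ p ≈ᴾ []
    +-inverseˡᴾ p = transᴾ (+-commᴾ (-ᴾ p) p) (+-inverseʳᴾ p)

    -‿congᴾ : ∀ {p q} → p ≈ᴾ q → -ᴾ p ≈ᴾ -ᴾ q
    -‿congᴾ {p} {q} e .at i = trans (coeff-- p i) (trans (-‿cong (at e i)) (sym (coeff-- q i)))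

    +-medialᴾ : ∀ p q r s → (p +ᴾ q) +ᴾ (r +ᴾ s) ≈ᴾ (p +ᴾ r) +ᴾ (q +ᴾ s)
    +-medialᴾ p q r s =
      transᴾ (+-assocᴾ p q (r +ᴾ s)) (transᴾ (+-congᴾ (reflᴾ {p})
        (transᴾ (symᴾ (+-assocᴾ q r s)) (transᴾ (+-congᴾ (+-commᴾ q r) (reflᴾ {s}))
          (+-assocᴾ r q s)))) (symᴾ (+-assocᴾ p r (q +ᴾ s))))

    ∷-cong : ∀ {a b p q} → a ≈ b → p ≈ᴾ q → (a ∷ p) ≈ᴾ (b ∷ q)
    ∷-cong e f .at zero    = e
    ∷-cong e f .at (suc i) = at f i

    0∷[] : (0# ∷ []) ≈ᴾ []
    0∷[] .at zero    = refl
    0∷[] .at (suc i) = refl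

    0∷-+ : ∀ p q → (0# ∷ p +ᴾ q) ≈ᴾ (0# ∷ p) +ᴾ (0# ∷ q)
    0∷-+ p q = ∷-cong (sym (+-identityˡ 0#)) reflᴾ

    ∙-cong : ∀ {s t p q} → s ≈ t → p ≈ᴾ q → s ∙ p ≈ᴾ t ∙ q
    ∙-cong {s} {t} {p} {q} e f .at i =
      trans (coeff-∙ s p i) (trans (*-cong e (at f i)) (sym (coeff-∙ t q i)))

    ∙-distribˡ : ∀ s p q → s ∙ (p +ᴾ q) ≈ᴾ s ∙ p +ᴾ s ∙ q
    ∙-distribˡ s p q .at i = begin
      coeff (s ∙ (p +ᴾ q)) i              ≈⟨ coeff-∙ s (p +ᴾ q) i ⟩
      s * coeff (p +ᴾ q) i                ≈⟨ *-congˡ (coeff-+ p q i) ⟩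
      s * (coeff p i + coeff q i)         ≈⟨ distribˡ _ _ _ ⟩
      s * coeff p i + s * coeff q i       ≈⟨ +-cong (coeff-∙ s p i) (coeff-∙ s q i) ⟨
      coeff (s ∙ p) i + coeff (s ∙ q) i   ≈⟨ coeff-+ (s ∙ p) (s ∙ q) i ⟨
      coeff (s ∙ p +ᴾ s ∙ q) i            ∎

    ∙-distribʳ : ∀ s t p → (s + t) ∙ p ≈ᴾ s ∙ p +ᴾ t ∙ p
    ∙-distribʳ s t []      .at i       = refl
    ∙-distribʳ s t (a ∷ p) .at zero    = distribʳ a s t
    ∙-distribʳ s t (a ∷ p) .at (suc i) = at (∙-distribʳ s t p) i

    ∙-assoc : ∀ s t p → (s * t) ∙ p ≈ᴾ s ∙ (t ∙ p)
    ∙-assoc s t []      .at i       = refl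
    ∙-assoc s t (a ∷ p) .at zero    = *-assoc s t a
    ∙-assoc s t (a ∷ p) .at (suc i) = at (∙-assoc s t p) i

    ∙-zero : ∀ p → 0# ∙ p ≈ᴾ []
    ∙-zero p .at i = trans (coeff-∙ 0# p i) (zeroˡ _)

    ∙-identity : ∀ p → 1# ∙ p ≈ᴾ p
    ∙-identity p .at i = trans (coeff-∙ 1# p i) (*-identityˡ _)

    0∷-∙ : ∀ s p → s ∙ (0# ∷ p) ≈ᴾ (0# ∷ s ∙ p)
    0∷-∙ s p = ∷-cong (zeroʳ s) reflᴾ

    *-zeroʳᴾ : ∀ p → p *ᴾ [] ≈ᴾ []
    *-zeroʳᴾ []      = reflᴾ
    *-zeroʳᴾ (a ∷ p) = transᴾ (∷-cong refl (*-zeroʳᴾ p)) 0∷[]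

    *-∷ : ∀ p b q → p *ᴾ (b ∷ q) ≈ᴾ b ∙ p +ᴾ (0# ∷ p *ᴾ q)
    *-∷ []      b q = symᴾ 0∷[]
    *-∷ (a ∷ p) b q = ∷-cong (+-congʳ (*-comm a b))
      (transᴾ (+-congᴾ (reflᴾ {a ∙ q}) (*-∷ p b q))
      (transᴾ (symᴾ (+-assocᴾ (a ∙ q) (b ∙ p) _))
      (transᴾ (+-congᴾ (+-commᴾ (a ∙ q) (b ∙ p)) reflᴾ)
        (+-assocᴾ (b ∙ p) (a ∙ q) _))))

    *-commᴾ : ∀ p q → p *ᴾ q ≈ᴾ q *ᴾ p
    *-commᴾ []      q = symᴾ (*-zeroʳᴾ q)
    *-commᴾ (a ∷ p) q =
      transᴾ (+-congᴾ (reflᴾ {a ∙ q}) (∷-cong refl (*-commᴾ p q))) (symᴾ (*-∷ q a p))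

    *-congˡᴾ : ∀ p {q r} → q ≈ᴾ r → p *ᴾ q ≈ᴾ p *ᴾ r
    *-congˡᴾ []      e = reflᴾ
    *-congˡᴾ (a ∷ p) e = +-congᴾ (∙-cong refl e) (∷-cong refl (*-congˡᴾ p e))

    *-congᴾ : ∀ {p q r s} → p ≈ᴾ q → r ≈ᴾ s → p *ᴾ r ≈ᴾ q *ᴾ s
    *-congᴾ {p} {q} {r} {s} e f = transᴾ (*-congˡᴾ p f)
      (transᴾ (*-commᴾ p s) (transᴾ (*-congˡᴾ s e) (*-commᴾ s q)))

    *-distribˡᴾ : ∀ p q r → p *ᴾ (q +ᴾ r) ≈ᴾ p *ᴾ q +ᴾ p *ᴾ r
    *-distribˡᴾ []      q r = reflᴾ
    *-distribˡᴾ (a ∷ p) q r =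
      transᴾ (+-congᴾ (∙-distribˡ a q r)
        (transᴾ (∷-cong refl (*-distribˡᴾ p q r)) (0∷-+ (p *ᴾ q) (p *ᴾ r))))
      (+-medialᴾ (a ∙ q) (a ∙ r) (0# ∷ p *ᴾ q) (0# ∷ p *ᴾ r))

    *-distribʳᴾ : ∀ p q r → (q +ᴾ r) *ᴾ p ≈ᴾ q *ᴾ p +ᴾ r *ᴾ p
    *-distribʳᴾ p q r = transᴾ (*-commᴾ (q +ᴾ r) p)
      (transᴾ (*-distribˡᴾ p q r) (+-congᴾ (*-commᴾ p q) (*-commᴾ p r)))

    ∙-*-assoc : ∀ s p q → (s ∙ p) *ᴾ q ≈ᴾ s ∙ (p *ᴾ q)
    ∙-*-assoc s []      q = reflᴾ
    ∙-*-assoc s (a ∷ p) q =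
      transᴾ (+-congᴾ (∙-assoc s a q)
        (transᴾ (∷-cong refl (∙-*-assoc s p q)) (symᴾ (0∷-∙ s (p *ᴾ q)))))
      (symᴾ (∙-distribˡ s (a ∙ q) (0# ∷ p *ᴾ q)))

    *-assocᴾ : ∀ p q r → (p *ᴾ q) *ᴾ r ≈ᴾ p *ᴾ (q *ᴾ r)
    *-assocᴾ []      q r = reflᴾ
    *-assocᴾ (a ∷ p) q r =
      transᴾ (*-distribʳᴾ r (a ∙ q) (0# ∷ p *ᴾ q))
      (+-congᴾ (∙-*-assoc a q r)
        (transᴾ (+-congᴾ (∙-zero r) (∷-cong refl (*-assocᴾ p q r))) reflᴾ))

    constant-* : ∀ s p → constant s *ᴾ p ≈ᴾ s ∙ p
    constant-* s p = transᴾ (+-congᴾ (reflᴾ {s ∙ p}) 0∷[]) (+-identityʳᴾ (s ∙ p))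

    *-identityˡᴾ : ∀ p → constant 1# *ᴾ p ≈ᴾ p
    *-identityˡᴾ p = transᴾ (constant-* 1# p) (∙-identity p)

    *-identityʳᴾ : ∀ p → p *ᴾ constant 1# ≈ᴾ p
    *-identityʳᴾ p = transᴾ (*-commᴾ p (constant 1#)) (*-identityˡᴾ p)

  polynomialRing : CommutativeRing c ℓ
  polynomialRing = record
    { Carrier = Poly ; _≈_ = _≈ᴾ_ ; _+_ = _+ᴾ_ ; _*_ = _*ᴾ_ ; -_ = -ᴾ_ ; 0# = [] ; 1# = constant 1#
    ; isCommutativeRing = record
      { isRing = record
        { +-isAbelianGroup = record
          { isGroup = record
            { isMonoid = record
              { isSemigroup = record
                { isMagma = record
                  { isEquivalence = record { refl = reflᴾ ; sym = symᴾ ; trans = transᴾ }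
                  ; ∙-cong = +-congᴾ
                  }
                ; assoc = +-assocᴾ
                }
              ; identity = +-identityˡᴾ , +-identityʳᴾ
              }
            ; inverse = +-inverseˡᴾ , +-inverseʳᴾ
            ; ⁻¹-cong = -‿congᴾ
            }
          ; comm = +-commᴾ
          }
        ; *-cong = *-congᴾ
        ; *-assoc = *-assocᴾ
        ; *-identity = *-identityˡᴾ , *-identityʳᴾ
        ; distrib = *-distribˡᴾ , *-distribʳᴾ
        }
      ; *-comm = *-commᴾ
      }
    }

  polynomialAlgebra : Algebra R c ℓ
  polynomialAlgebra = record
    { ring = CommutativeRing.ring polynomialRing
    ; ι = constant
    ; ι-isRingHomomorphism = record
      { isSemiringHomomorphism = record
        { isNearSemiringHomomorphism = record
          { +-isMonoidHomomorphism = record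
            { isMagmaHomomorphism = record
              { isRelHomomorphism = record { cong = λ e → ∷-cong e reflᴾ }
              ; homo = λ _ _ → reflᴾ
              }
            ; ε-homo = 0∷[]
            }
          ; *-homo = λ s t → ∷-cong (sym (+-identityʳ (s * t))) reflᴾ
          }
        ; 1#-homo = reflᴾ
        }
      ; -‿homo = λ _ → reflᴾ
      }
    ; ι-central = λ s p → *-commᴾ (constant s) p
    }

module Whitney (R : CommutativeRing c ℓ) where

  open CommutativeRing R
  open import Algebra.Properties.Semiring.Exp semiring using (_^_)
  open import Algebra.Properties.Semiring.Mult semiring using (_×_)
  open Summation semiring

  fromℕ : ℕ → Carrier
  fromℕ n = n × 1#

  falling : (x step : Carrier) → ℕ → Carrier
  falling x step zero    = 1#
  falling x step (suc n) = falling x step n * (x - fromℕ n * step)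

  -- The defining expansion only involves W n k with k ≤ n, and determines
  -- those values when R = ℝ and m ≥ 1.
  IsWhitney : (m : ℕ) (r step : Carrier) → (ℕ → ℕ → Carrier) → Set (c ⊔ ℓ)
  IsWhitney m r step W = ∀ n x →
    falling (fromℕ m * x + r) step n
      ≈ ∑[ k ≤ n ] (W n k * fromℕ m ^ k * falling x 1# k)

module _ {R : CommutativeRing c ℓ} (A : Algebra R a ℓᵃ) where

  open Algebra A

  -- Taking A = R[X] and y = X gives the degenerate r-Dowling polynomial
  -- itself, other choices its value at y.
  dowling : (ℕ → ℕ → CommutativeRing.Carrier R) → ℕ → Carrier → Carrier
  dowling W n y = ∑[ k ≤ n ] (W n k · y ^ k)

open Whitney ℝ-commutativeRing public
open import Algebra.Properties.Semiring.Exp (CommutativeRing.semiring ℝ-commutativeRing) public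
  using () renaming (_^_ to infixr 8 _^ᴿ_)

ℝ[X] : Algebra ℝ-commutativeRing 0ℓ 0ℓ
ℝ[X] = Polynomial.polynomialAlgebra ℝ-commutativeRing

open Polynomial ℝ-commutativeRing public using (X)

-- The annihilation and creation operators enter only through the canonical
-- commutation relation [ a , a⁺ ] = 1, in an arbitrary associative ℝ-algebra.
record BosonAlgebra (a ℓᵃ : Level) : Set (lsuc (a ⊔ ℓᵃ)) where
  field
    algebra : Algebra ℝ-commutativeRing a ℓᵃ
  open Algebra algebra public
  field
    annihilation creation : Carrier
    commutation : annihilation * creation - creation * annihilation ≈ 1#

module Submission where

-- Splitting the falling factorial and expanding the second factor around each
-- j by the Vandermonde identity gives
--   (mx+r)_{l+n,λ} = (mx+r)_{l,λ} ((m(x-j)+r) + (mj-lλ))_{n,λ}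
--     = Σ_j Σ_k Σ_i C(n,k) W(l,j) (mj-lλ)_{n-k,λ} W(k,i) m^{j+i} (x)_{j+i},
-- because (x)_j (x-j)_i = (x)_{j+i}.  The products m^p (x)_p are linearly
-- independent, so W(l+n,p) is the sum of the coefficients with j + i = p, and
-- replacing m^p (x)_p by y^p gives the claim at any element y of any algebra;
-- y = X and y = m a⁺ are the two assertions.

open import Defs hiding (fromℕ; falling; IsWhitney)
open import Algebra.Bundles using (CommutativeRing; Semiring)
open import Algebra.Morphism.Structures using (IsRingHomomorphism)
import Algebra.Morphism.Construct.Identity as Identity
import Algebra.Properties.Group as GroupProperties
import Algebra.Properties.AbelianGroup as AbelianGroupProperties
import Algebra.Properties.CommutativeSemigroup as CommutativeSemigroupProperties
import Algebra.Properties.Ring as RingProperties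
import Algebra.Properties.Semiring.Exp as Exp
import Algebra.Properties.Semiring.Mult as Mult
import Algebra.Properties.Semiring.Sum as Sum
import Algebra.Solver.CommutativeMonoid as CommutativeMonoidSolver
open import Data.Fin using (toℕ)
open import Data.Fin.Properties using (toℕ≤pred[n])
open import Data.Nat as ℕ using (ℕ; zero; suc; NonZero; _∸_; _≤_; z≤n; s≤s)
open import Data.Nat.Combinatorics using (nCk+nC[k+1]≡[n+1]C[k+1]; k>n⇒nCk≡0)
import Data.Nat.Properties as ℕ
open import Data.Product using (_×_; _,_; ∃-syntax)
open import Data.Rational as ℚ using (ℚ; 0ℚ; 1ℚ)
import Data.Rational.Properties as ℚ
open import Level using (Level; _⊔_)
open import Relation.Binary.PropositionalEquality as ≡ using (_≡_)
import Relation.Binary.Reasoning.Setoid as SetoidReasoning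
open import Relation.Nullary using (¬_)

private variable
  c ℓ a ℓᵃ : Level

-- Finite sums over the indices 0 to n in a semiring.

module BoundedSums (S : Semiring c ℓ) where

  open Semiring S
  open Summation S
  open Sum S

  ∑-cong : ∀ n {f g : ℕ → Carrier} → (∀ k → k ≤ n → f k ≈ g k) → ∑≤ n f ≈ ∑≤ n g
  ∑-cong n h = sum-cong-≋ {suc n} (λ i → h (toℕ i) (toℕ≤pred[n] i))

  ∑-swap : ∀ m n (f : ℕ → ℕ → Carrier) →
    ∑≤ m (λ i → ∑≤ n (f i)) ≈ ∑≤ n (λ j → ∑≤ m (λ i → f i j))
  ∑-swap m n f = ∑-comm {suc m} {suc n} (λ i j → f (toℕ i) (toℕ j))

  *-distribˡ-∑ : ∀ n x (f : ℕ → Carrier) → x * ∑≤ n f ≈ ∑≤ n (λ k → x * f k)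
  *-distribˡ-∑ n x f = *-distribˡ-sum {suc n} x (λ i → f (toℕ i))

  *-distribʳ-∑ : ∀ n x (f : ℕ → Carrier) → ∑≤ n f * x ≈ ∑≤ n (λ k → f k * x)
  *-distribʳ-∑ n x f = *-distribʳ-sum {suc n} x (λ i → f (toℕ i))

  ∑-distrib : ∀ n (f g : ℕ → Carrier) → ∑≤ n (λ k → f k + g k) ≈ ∑≤ n f + ∑≤ n g
  ∑-distrib n f g = ∑-distrib-+ {suc n} (λ i → f (toℕ i)) (λ i → g (toℕ i))

  ∑-zero : ∀ n {f : ℕ → Carrier} → (∀ k → f k ≈ 0#) → ∑≤ n f ≈ 0#
  ∑-zero n h = trans (∑-cong n (λ k _ → h k)) (sum-replicate-zero (suc n))

  -- `∑≤` unfolds from index 0 by definition, so splitting off the top index takes an induction.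
  ∑-last : ∀ n (f : ℕ → Carrier) → ∑≤ (suc n) f ≈ ∑≤ n f + f (suc n)
  ∑-last zero    f = trans (+-congˡ (+-identityʳ _)) (+-congʳ (sym (+-identityʳ _)))
  ∑-last (suc n) f = trans (+-congˡ (∑-last n (λ k → f (suc k)))) (sym (+-assoc _ _ _))

-- Generalised falling factorials and their Vandermonde identity.

module FallingFactorials (R : CommutativeRing c ℓ) where

  open CommutativeRing R
  open Whitney R
  open Summation semiring
  open BoundedSums semiring
  open Mult semiring using (×-homo-+)
  open RingProperties ring using (-0#≈0#)
  open AbelianGroupProperties +-abelianGroup using (⁻¹-∙-comm; xyx⁻¹≈y)
  open GroupProperties +-group using () renaming (∙-cancelˡ to +-cancelˡ)
  open Exp semiring using (_^_)
  open CommutativeSemigroupProperties *-commutativeSemigroup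
    using () renaming (x∙yz≈y∙xz to x*yz≈y*xz)
  open CommutativeSemigroupProperties +-commutativeSemigroup
    using () renaming (xy∙z≈xz∙y to x+y+z≈x+z+y)
  open SetoidReasoning setoid

  fromℕ-+ : ∀ m n → fromℕ (m ℕ.+ n) ≈ fromℕ m + fromℕ n
  fromℕ-+ = ×-homo-+ 1#

  -‿congˡ : ∀ {x y z} → y ≈ z → x - y ≈ x - z
  -‿congˡ e = +-congˡ (-‿cong e)

  x-0*y≈x : ∀ x y → x - 0# * y ≈ x
  x-0*y≈x x y = trans (-‿congˡ (zeroˡ y)) (trans (+-congˡ -0#≈0#) (+-identityʳ x))

  falling-cong : ∀ {x y s t} → x ≈ y → s ≈ t → ∀ n → falling x s n ≈ falling y t n
  falling-cong e f zero    = refl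
  falling-cong e f (suc n) = *-cong (falling-cong e f n) (+-cong e (-‿cong (*-congˡ f)))

  -- Induction on `n`: the last factor x - (l+n)s on the left is (x - ls) - ns, the last factor of
  -- the shifted falling factorial.
  falling-+ : ∀ x s l n →
    falling x s (l ℕ.+ n) ≈ falling x s l * falling (x - fromℕ l * s) s n
  falling-+ x s l zero rewrite ℕ.+-identityʳ l = sym (*-identityʳ _)
  falling-+ x s l (suc n) rewrite ℕ.+-suc l n = begin
    falling x s (l ℕ.+ n) * (x - fromℕ (l ℕ.+ n) * s)
      ≈⟨ *-cong (falling-+ x s l n) shift ⟩
    falling x s l * falling (x - fromℕ l * s) s n * (x - fromℕ l * s - fromℕ n * s)
      ≈⟨ *-assoc _ _ _ ⟩
    falling x s l * falling (x - fromℕ l * s) s (suc n) ∎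
    where
    shift : x - fromℕ (l ℕ.+ n) * s ≈ x - fromℕ l * s - fromℕ n * s
    shift = begin
      x - fromℕ (l ℕ.+ n) * s               ≈⟨ -‿congˡ (*-congʳ (fromℕ-+ l n)) ⟩
      x - (fromℕ l + fromℕ n) * s           ≈⟨ -‿congˡ (distribʳ s _ _) ⟩
      x - (fromℕ l * s + fromℕ n * s)       ≈⟨ +-congˡ (⁻¹-∙-comm _ _) ⟨
      x + (- (fromℕ l * s) - fromℕ n * s)   ≈⟨ +-assoc _ _ _ ⟨
      x - fromℕ l * s - fromℕ n * s         ∎

  -- The definition splits off the last factor; `falling-+` with `l` equal to 1 splits off the
  -- first.
  falling-suc : ∀ x s n → falling x s (suc n) ≈ x * falling (x - s) s n
  falling-suc x s n = trans (falling-+ x s 1 n)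
    (*-cong (trans (*-identityˡ _) (x-0*y≈x x s))
      (falling-cong (-‿congˡ (trans (*-congʳ (+-identityʳ 1#)) (*-identityˡ s))) refl n))

  falling-zero : ∀ s n → falling 0# s (suc n) ≈ 0#
  falling-zero s n = trans (falling-suc 0# s n) (zeroˡ _)

  falling-fromℕ-suc : ∀ q n →
    falling (fromℕ (suc q)) 1# (suc n) ≈ fromℕ (suc q) * falling (fromℕ q) 1# n
  falling-fromℕ-suc q n = trans (falling-suc (fromℕ (suc q)) 1# n)
    (*-congˡ (falling-cong (xyx⁻¹≈y 1# (fromℕ q)) refl n))

  -- Split off the first factor x + y and distribute. The part with x uses the induction hypothesis
  -- at (x - s, y), the part with y at (x, y - s); x or y is then absorbed as a new first factor,
  -- and Pascal's rule merges the two sums.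
  vandermonde : ∀ x y s n →
    falling (x + y) s n
      ≈ ∑[ k ≤ n ] (fromℕ (n C k) * (falling y s (n ∸ k) * falling x s k))
  vandermonde x y s zero = sym (begin
    (1# + 0#) * (1# * 1#) + 0#   ≈⟨ +-identityʳ _ ⟩
    (1# + 0#) * (1# * 1#)        ≈⟨ *-cong (+-identityʳ 1#) (*-identityʳ 1#) ⟩
    1# * 1#                      ≈⟨ *-identityʳ 1# ⟩
    1#                           ∎)
  vandermonde x y s (suc n) = begin
    falling (x + y) s (suc n)
      ≈⟨ falling-suc (x + y) s n ⟩
    (x + y) * falling (x + y - s) s n
      ≈⟨ distribʳ _ x y ⟩
    x * falling (x + y - s) s n + y * falling (x + y - s) s n
      ≈⟨ +-cong lower-x lower-y ⟩
    ∑≤ n u + ∑≤ (suc n) v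
      ≈⟨ +-comm _ _ ⟩
    -- `∑≤ (suc n) v` unfolds to this head and tail. As `n C 0` and `suc n C 0` compute to the same
    -- number, `v 0` is already the `k = 0` term of the goal.
    v 0 + ∑≤ n (λ k → v (suc k)) + ∑≤ n u
      ≈⟨ +-assoc _ _ _ ⟩
    v 0 + (∑≤ n (λ k → v (suc k)) + ∑≤ n u)
      ≈⟨ +-congˡ (∑-distrib n (λ k → v (suc k)) u) ⟨
    v 0 + ∑≤ n (λ k → v (suc k) + u k)
      ≈⟨ +-congˡ (∑-cong n (λ k _ → pascal k)) ⟩
    ∑≤ (suc n) (λ k → fromℕ (suc n C k) * (falling y s (suc n ∸ k) * falling x s k)) ∎
    where
    u v u′ v′ : ℕ → Carrier
    u k  = fromℕ (n C k) * (falling y s (n ∸ k) * falling x s (suc k))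
    v k  = fromℕ (n C k) * (falling y s (suc n ∸ k) * falling x s k)
    u′ k = fromℕ (n C k) * (falling y s (n ∸ k) * falling (x - s) s k)
    v′ k = fromℕ (n C k) * (falling (y - s) s (n ∸ k) * falling x s k)

    pascal : ∀ k → v (suc k) + u k
                 ≈ fromℕ (suc n C suc k) * (falling y s (n ∸ k) * falling x s (suc k))
    pascal k = begin
      fromℕ (n C suc k) * g + fromℕ (n C k) * g   ≈⟨ distribʳ _ _ _ ⟨
      (fromℕ (n C suc k) + fromℕ (n C k)) * g     ≈⟨ *-congʳ (+-comm _ _) ⟩
      (fromℕ (n C k) + fromℕ (n C suc k)) * g     ≈⟨ *-congʳ (fromℕ-+ (n C k) (n C suc k)) ⟨
      fromℕ (n C k ℕ.+ n C suc k) * g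
        ≡⟨ ≡.cong (λ z → fromℕ z * g) (nCk+nC[k+1]≡[n+1]C[k+1] n k) ⟩
      fromℕ (suc n C suc k) * g                   ∎
      where
      g : Carrier
      g = falling y s (n ∸ k) * falling x s (suc k)

    u′⇒u : ∀ k → x * u′ k ≈ u k
    u′⇒u k = begin
      x * u′ k
        ≈⟨ x*yz≈y*xz _ _ _ ⟩
      fromℕ (n C k) * (x * (falling y s (n ∸ k) * falling (x - s) s k))
        ≈⟨ *-congˡ (x*yz≈y*xz _ _ _) ⟩
      fromℕ (n C k) * (falling y s (n ∸ k) * (x * falling (x - s) s k))
        ≈⟨ *-congˡ (*-congˡ (falling-suc x s k)) ⟨
      u k ∎

    v′⇒v : ∀ k → k ≤ n → y * v′ k ≈ v k
    v′⇒v k k≤n = begin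
      y * v′ k
        ≈⟨ x*yz≈y*xz _ _ _ ⟩
      fromℕ (n C k) * (y * (falling (y - s) s (n ∸ k) * falling x s k))
        ≈⟨ *-congˡ (*-assoc _ _ _) ⟨
      fromℕ (n C k) * (y * falling (y - s) s (n ∸ k) * falling x s k)
        ≈⟨ *-congˡ (*-congʳ (falling-suc y s (n ∸ k))) ⟨
      fromℕ (n C k) * (falling y s (suc (n ∸ k)) * falling x s k)
        -- Subtraction is truncated, so `suc n ∸ k` becomes `suc (n ∸ k)` only for `k ≤ n`.
        ≡⟨ ≡.cong (λ i → fromℕ (n C k) * (falling y s i * falling x s k)) (ℕ.+-∸-assoc 1 k≤n) ⟨
      v k ∎

    v-last : v (suc n) ≈ 0#
    v-last rewrite k>n⇒nCk≡0 (ℕ.n<1+n n) = zeroˡ _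

    lower-x : x * falling (x + y - s) s n ≈ ∑≤ n u
    lower-x = begin
      x * falling (x + y - s) s n   ≈⟨ *-congˡ (falling-cong (x+y+z≈x+z+y x y (- s)) refl n) ⟩
      x * falling (x - s + y) s n   ≈⟨ *-congˡ (vandermonde (x - s) y s n) ⟩
      x * ∑≤ n u′                   ≈⟨ *-distribˡ-∑ n x u′ ⟩
      ∑≤ n (λ k → x * u′ k)         ≈⟨ ∑-cong n (λ k _ → u′⇒u k) ⟩
      ∑≤ n u                        ∎

    lower-y : y * falling (x + y - s) s n ≈ ∑≤ (suc n) v
    lower-y = begin
      y * falling (x + y - s) s n     ≈⟨ *-congˡ (falling-cong (+-assoc x y (- s)) refl n) ⟩
      y * falling (x + (y - s)) s n   ≈⟨ *-congˡ (vandermonde x (y - s) s n) ⟩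
      y * ∑≤ n v′                     ≈⟨ *-distribˡ-∑ n y v′ ⟩
      ∑≤ n (λ k → y * v′ k)           ≈⟨ ∑-cong n v′⇒v ⟩
      -- Since `n C suc n` is 0, the range may be extended to `suc n`; the tail of `v` then lines up
      -- with `u`.
      ∑≤ n v                          ≈⟨ +-identityʳ _ ⟨
      ∑≤ n v + 0#                     ≈⟨ +-congˡ v-last ⟨
      ∑≤ n v + v (suc n)              ≈⟨ ∑-last n v ⟨
      ∑≤ (suc n) v                    ∎

  -- Linear independence of the falling factorials when positive integers cancel.

  Cancellable : Set (c ⊔ ℓ)
  Cancellable = ∀ n .{{_ : NonZero n}} y z → fromℕ n * y ≈ fromℕ n * z → y ≈ z

  module _ (cancel : Cancellable) where

    ^-cancel : ∀ m .{{_ : NonZero m}} n y z → fromℕ m ^ n * y ≈ fromℕ m ^ n * z → y ≈ z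
    ^-cancel m zero    y z e = trans (sym (*-identityˡ y)) (trans e (*-identityˡ z))
    ^-cancel m (suc n) y z e = ^-cancel m n y z
      (cancel m _ _ (trans (sym (*-assoc _ _ y)) (trans e (*-assoc _ _ z))))

    -- Every (0)_k with k ≥ 1 contains the factor 0.
    constant-term : ∀ N (f : ℕ → Carrier) → ∑[ k ≤ N ] (f k * falling 0# 1# k) ≈ f 0
    constant-term zero    f = trans (+-identityʳ _) (*-identityʳ _)
    constant-term (suc N) f = begin
      f 0 * 1# + (∑[ k ≤ N ] (f (suc k) * falling 0# 1# (suc k)))
        ≈⟨ +-cong (*-identityʳ _)
             (∑-zero N (λ k → trans (*-congˡ (falling-zero 1# k)) (zeroʳ (f (suc k))))) ⟩
      f 0 + 0#   ≈⟨ +-identityʳ _ ⟩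
      f 0        ∎

    higher-terms : ∀ N (f : ℕ → Carrier) q →
      ∑[ k ≤ N ] (f (suc k) * falling (fromℕ (suc q)) 1# (suc k))
        ≈ fromℕ (suc q) * (∑[ k ≤ N ] (f (suc k) * falling (fromℕ q) 1# k))
    higher-terms N f q = begin
      ∑[ k ≤ N ] (f (suc k) * falling (fromℕ (suc q)) 1# (suc k))
        ≈⟨ ∑-cong N (λ k _ → trans (*-congˡ (falling-fromℕ-suc q k)) (x*yz≈y*xz (f (suc k)) _ _)) ⟩
      ∑[ k ≤ N ] (fromℕ (suc q) * (f (suc k) * falling (fromℕ q) 1# k))
        ≈⟨ *-distribˡ-∑ N (fromℕ (suc q)) (λ k → f (suc k) * falling (fromℕ q) 1# k) ⟨
      fromℕ (suc q) * (∑[ k ≤ N ] (f (suc k) * falling (fromℕ q) 1# k)) ∎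

    -- At 0 only the constant terms survive; once they agree, both sides at
    -- q + 1 are q + 1 times expansions at q with the coefficients shifted.
    falling-independent : ∀ N (f g : ℕ → Carrier) →
      (∀ q → ∑[ k ≤ N ] (f k * falling (fromℕ q) 1# k) ≈ ∑[ k ≤ N ] (g k * falling (fromℕ q) 1# k)) →
      ∀ k → k ≤ N → f k ≈ g k
    falling-independent N f g e zero    _ =
      trans (sym (constant-term N f)) (trans (e 0) (constant-term N g))
    falling-independent (suc N) f g e (suc k) (s≤s k≤N) =
      falling-independent N (λ i → f (suc i)) (λ i → g (suc i)) shifted k k≤N
      where
      f₀≈g₀ : f 0 ≈ g 0
      f₀≈g₀ = falling-independent (suc N) f g e 0 z≤n

      shifted : ∀ q → ∑[ i ≤ N ] (f (suc i) * falling (fromℕ q) 1# i)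
                    ≈ ∑[ i ≤ N ] (g (suc i) * falling (fromℕ q) 1# i)
      shifted q = cancel (suc q) _ _ (begin
        fromℕ (suc q) * (∑[ i ≤ N ] (f (suc i) * falling (fromℕ q) 1# i))
          ≈⟨ higher-terms N f q ⟨
        ∑[ i ≤ N ] (f (suc i) * falling (fromℕ (suc q)) 1# (suc i))
          ≈⟨ +-cancelˡ (f 0 * 1#) _ _ (trans (e (suc q)) (+-congʳ (*-congʳ (sym f₀≈g₀)))) ⟩
        ∑[ i ≤ N ] (g (suc i) * falling (fromℕ (suc q)) 1# (suc i))
          ≈⟨ higher-terms N g q ⟩
        fromℕ (suc q) * (∑[ i ≤ N ] (g (suc i) * falling (fromℕ q) 1# i)) ∎)

-- The ring as an algebra over itself, and scalar multiplication in an arbitrary algebra.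

selfAlgebra : (R : CommutativeRing c ℓ) → Algebra R c ℓ
selfAlgebra R = record
  { ring                 = ring
  ; ι                    = λ x → x
  ; ι-isRingHomomorphism = Identity.isRingHomomorphism rawRing refl
  ; ι-central            = *-comm
  }
  where open CommutativeRing R

module Scalars {R : CommutativeRing c ℓ} (A : Algebra R a ℓᵃ) where

  private
    module R where
      open CommutativeRing R public
      open Summation semiring public
      open Exp semiring public using (_^_)

  open Algebra A
  open BoundedSums semiring
  open IsRingHomomorphism ι-isRingHomomorphism using (+-homo; *-homo; 0#-homo; 1#-homo)
    renaming (⟦⟧-cong to ι-cong)
  open SetoidReasoning setoid

  ·-cong : ∀ {s t x y} → s R.≈ t → x ≈ y → s · x ≈ t · y
  ·-cong e f = *-cong (ι-cong e) f

  ·-congʳ : ∀ {s t} x → s R.≈ t → s · x ≈ t · x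
  ·-congʳ x e = ·-cong e (refl {x})

  *-· : ∀ s t x → (s R.* t) · x ≈ s · (t · x)
  *-· s t x = trans (*-congʳ (*-homo s t)) (*-assoc _ _ x)

  -- This rests on centrality of scalars alone, so it holds in noncommutative algebras such as a
  -- boson algebra.
  ·-*-comm : ∀ s x y → x * (s · y) ≈ s · (x * y)
  ·-*-comm s x y = begin
    x * (ι s * y)   ≈⟨ *-assoc _ _ _ ⟨
    x * ι s * y     ≈⟨ *-congʳ (ι-central s x) ⟨
    ι s * x * y     ≈⟨ *-assoc _ _ _ ⟩
    ι s * (x * y)   ∎

  0·x≈0 : ∀ x → R.0# · x ≈ 0#
  0·x≈0 x = trans (*-congʳ 0#-homo) (zeroˡ x)

  1·x≈x : ∀ x → R.1# · x ≈ x
  1·x≈x x = trans (*-congʳ 1#-homo) (*-identityˡ x)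

  ·-^ : ∀ s x n → (s · x) ^ n ≈ (s R.^ n) · x ^ n
  ·-^ s x zero    = sym (1·x≈x 1#)
  ·-^ s x (suc n) = begin
    (s · x) * (s · x) ^ n            ≈⟨ *-congˡ (·-^ s x n) ⟩
    (s · x) * ((s R.^ n) · x ^ n)    ≈⟨ *-assoc _ _ _ ⟩
    s · (x * ((s R.^ n) · x ^ n))    ≈⟨ *-congˡ (·-*-comm (s R.^ n) x (x ^ n)) ⟩
    s · (s R.^ n) · x ^ suc n        ≈⟨ *-· s (s R.^ n) _ ⟨
    (s R.^ suc n) · x ^ suc n        ∎

  ∑-· : ∀ n (f : ℕ → R.Carrier) x → R.∑≤ n f · x ≈ ∑[ k ≤ n ] (f k · x)
  ∑-· zero    f x = begin
    (f 0 R.+ R.0#) · x   ≈⟨ *-congʳ (ι-cong (R.+-identityʳ _)) ⟩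
    f 0 · x              ≈⟨ +-identityʳ _ ⟨
    f 0 · x + 0#         ∎
  ∑-· (suc n) f x = begin
    (f 0 R.+ R.∑≤ n (λ k → f (suc k))) · x          ≈⟨ *-congʳ (+-homo _ _) ⟩
    (ι (f 0) + ι (R.∑≤ n (λ k → f (suc k)))) * x    ≈⟨ distribʳ x _ _ ⟩
    f 0 · x + (R.∑≤ n (λ k → f (suc k)) · x)        ≈⟨ +-congˡ (∑-· n (λ k → f (suc k)) x) ⟩
    f 0 · x + (∑[ k ≤ n ] (f (suc k) · x))          ∎

  -- Moves one summation out of the coefficients and past the sum over `p`; nested coefficient sums
  -- are unpacked by repeating it.
  ∑-∑-· : ∀ N n (g : ℕ → ℕ → R.Carrier) (b : ℕ → Carrier) →
    ∑[ p ≤ N ] (R.∑≤ n (λ k → g k p) · b p) ≈ ∑[ k ≤ n ] ∑[ p ≤ N ] (g k p · b p)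
  ∑-∑-· N n g b = trans (∑-cong N (λ p _ → ∑-· n (λ k → g k p) (b p)))
    (∑-swap N n (λ p k → g k p · b p))

-- Kronecker delta and the sums it collapses.

module Kronecker (R : CommutativeRing c ℓ) where

  open CommutativeRing R

  -- Recursion on both indices, rather than a decision of equality, lets `δ` reduce along the
  -- induction in `∑-δ`.
  δ : ℕ → ℕ → Carrier
  δ zero    zero    = 1#
  δ zero    (suc p) = 0#
  δ (suc q) zero    = 0#
  δ (suc q) (suc p) = δ q p

  module _ (A : Algebra R a ℓᵃ) where

    private module A = Algebra A
    open Scalars A
    open BoundedSums A.semiring
    open SetoidReasoning A.setoid

    ∑-δ : ∀ {N q} (b : ℕ → A.Carrier) → q ≤ N → A.∑≤ N (λ p → δ q p A.· b p) A.≈ b q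
    ∑-δ {zero}  b z≤n       = A.trans (A.+-identityʳ _) (1·x≈x (b 0))
    ∑-δ {suc N} b z≤n       = A.trans
      (A.+-cong (1·x≈x (b 0)) (∑-zero N (λ p → 0·x≈0 (b (suc p))))) (A.+-identityʳ _)
    ∑-δ {suc N} b (s≤s q≤N) = A.trans
      (A.+-cong (0·x≈0 (b 0)) (∑-δ (λ p → b (suc p)) q≤N)) (A.+-identityˡ _)

    ∑-*δ : ∀ {N q} e (b : ℕ → A.Carrier) → q ≤ N →
      A.∑≤ N (λ p → (e * δ q p) A.· b p) A.≈ e A.· b q
    ∑-*δ {N} {q} e b q≤N = begin
      A.∑≤ N (λ p → (e * δ q p) A.· b p)      ≈⟨ ∑-cong N (λ p _ → *-· e (δ q p) (b p)) ⟩
      A.∑≤ N (λ p → e A.· (δ q p A.· b p))    ≈⟨ *-distribˡ-∑ N (A.ι e) (λ p → δ q p A.· b p) ⟨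
      e A.· A.∑≤ N (λ p → δ q p A.· b p)      ≈⟨ A.*-congˡ (∑-δ b q≤N) ⟩
      e A.· b q                               ∎

-- Coefficients of the addition formula.

module DowlingAddition
  (R : CommutativeRing c ℓ) (cancel : FallingFactorials.Cancellable R)
  (m : ℕ) .{{_ : NonZero m}} (r s : CommutativeRing.Carrier R)
  (W : ℕ → ℕ → CommutativeRing.Carrier R) (isWhitney : Whitney.IsWhitney R m r s W)
  where

  open CommutativeRing R
  open Whitney R
  open Summation semiring
  open Exp semiring using (_^_; ^-homo-*)
  open BoundedSums semiring
  open FallingFactorials R
  open Kronecker R
  open GroupProperties +-group using (//-rightDividesˡ)
  open CommutativeSemigroupProperties +-commutativeSemigroup
    using () renaming (xy∙z≈xz∙y to x+y+z≈x+z+y)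
  open RingProperties ring using (x[y-z]≈xy-xz)
  open CommutativeMonoidSolver *-commutativeMonoid using (solve; _⊕_; _⊜_)

  -- What must be added to m(x - j) + r to obtain mx + r - ls.
  offset : (l j : ℕ) → Carrier
  offset l j = fromℕ m * fromℕ j - fromℕ l * s

  term : (l n j k i : ℕ) → Carrier
  term l n j k i = (fromℕ (n C k) * W l j) * (falling (offset l j) s (n ∸ k) * W k i)

  -- The delta selects the terms with j + i = p while the index ranges stay independent of `p`, so
  -- that the sums can be interchanged.
  collected : (l n p : ℕ) → Carrier
  collected l n p = ∑[ j ≤ l ] ∑[ k ≤ n ] ∑[ i ≤ k ] (term l n j k i * δ (j ℕ.+ i) p)

  module _ (A : Algebra R a ℓᵃ) where

    private module A = Algebra A
    open Scalars A
    private module AΣ = BoundedSums A.semiring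

    -- After moving the sum over `p` inside, the delta leaves the single index j + i, which lies in
    -- range because j ≤ l and i ≤ k ≤ n. The family `b` is arbitrary: it will be both the basis m^p
    -- (x)_p and the powers of an algebra element.
    expand : ∀ l n (b : ℕ → A.Carrier) →
      A.∑≤ (l ℕ.+ n) (λ p → collected l n p A.· b p)
        A.≈ A.∑≤ l λ j → A.∑≤ n λ k → A.∑≤ k λ i → term l n j k i A.· b (j ℕ.+ i)
    expand l n b =
      A.trans (∑-∑-· N l (λ j p → ∑[ k ≤ n ] ∑[ i ≤ k ] coefficient j k i p) b)
        (AΣ.∑-cong l λ j j≤l →
      A.trans (∑-∑-· N n (λ k p → ∑[ i ≤ k ] coefficient j k i p) b)
        (AΣ.∑-cong n λ k k≤n →
      A.trans (∑-∑-· N k (λ i p → coefficient j k i p) b)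
        (AΣ.∑-cong k λ i i≤k →
      ∑-*δ A (term l n j k i) b (ℕ.+-mono-≤ j≤l (ℕ.≤-trans i≤k k≤n)))))
      where
      N : ℕ
      N = l ℕ.+ n

      coefficient : (j k i p : ℕ) → Carrier
      coefficient j k i p = term l n j k i * δ (j ℕ.+ i) p

  -- Expansion of the split falling factorial at a point.

  module _ (x : Carrier) where

    open SetoidReasoning setoid

    basis : ℕ → Carrier
    basis p = fromℕ m ^ p * falling x 1# p

    -- Makes x - j the variable of the second factor, so that its expansion in (x - j)_i can be
    -- joined to (x)_j.
    recentre : ∀ l j →
      fromℕ m * x + r - fromℕ l * s ≈ (fromℕ m * (x - fromℕ j) + r) + offset l j
    recentre l j = sym (begin
      (fromℕ m * (x - fromℕ j) + r) + (mj - ls)    ≈⟨ +-congʳ (+-congʳ (x[y-z]≈xy-xz _ _ _)) ⟩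
      (fromℕ m * x - mj + r) + (mj - ls)           ≈⟨ +-congʳ (x+y+z≈x+z+y _ _ _) ⟩
      (fromℕ m * x + r - mj) + (mj - ls)           ≈⟨ +-assoc _ _ _ ⟨
      (fromℕ m * x + r - mj) + mj - ls             ≈⟨ +-congʳ (//-rightDividesˡ mj _) ⟩
      fromℕ m * x + r - ls                         ∎)
      where
      mj ls : Carrier
      mj = fromℕ m * fromℕ j
      ls = fromℕ l * s

    basis-+ : ∀ j i →
      basis (j ℕ.+ i) ≈ (fromℕ m ^ j * fromℕ m ^ i) * (falling x 1# j * falling (x - fromℕ j) 1# i)
    basis-+ j i = *-cong (^-homo-* (fromℕ m) j i) (trans (falling-+ x 1# j i)
      (*-congˡ (falling-cong (-‿congˡ (*-identityʳ (fromℕ j))) refl i)))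

    rearrange : ∀ w u v b f w′ u′ v′ →
      (w * u * v) * (b * (f * (w′ * u′ * v′))) ≈ ((b * w) * (f * w′)) * ((u * u′) * (v * v′))
    rearrange = solve 8 (λ w u v b f w′ u′ v′ →
      (((w ⊕ u) ⊕ v) ⊕ (b ⊕ (f ⊕ ((w′ ⊕ u′) ⊕ v′))))
        ⊜ (((b ⊕ w) ⊕ (f ⊕ w′)) ⊕ ((u ⊕ u′) ⊕ (v ⊕ v′)))) refl

    falling-expansion : ∀ l n →
      falling (fromℕ m * x + r) s (l ℕ.+ n)
        ≈ ∑[ j ≤ l ] ∑[ k ≤ n ] ∑[ i ≤ k ] (term l n j k i * basis (j ℕ.+ i))
    falling-expansion l n = begin
      falling z s (l ℕ.+ n)              ≈⟨ falling-+ z s l n ⟩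
      falling z s l * rest               ≈⟨ *-congʳ (isWhitney l x) ⟩
      ∑≤ l w * rest                      ≈⟨ *-distribʳ-∑ l rest w ⟩
      ∑[ j ≤ l ] (w j * rest)            ≈⟨ ∑-cong l (λ j _ → outer j) ⟩
      ∑[ j ≤ l ] ∑[ k ≤ n ] ∑[ i ≤ k ] (term l n j k i * basis (j ℕ.+ i)) ∎
      where
      z rest : Carrier
      z    = fromℕ m * x + r
      rest = falling (z - fromℕ l * s) s n

      w : ℕ → Carrier
      w j = W l j * fromℕ m ^ j * falling x 1# j

      w′ : (j k i : ℕ) → Carrier
      w′ j k i = W k i * fromℕ m ^ i * falling (x - fromℕ j) 1# i

      B : ℕ → Carrier
      B k = fromℕ (n C k)

      F G : (j k : ℕ) → Carrier
      F j k = falling (offset l j) s (n ∸ k)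
      G j k = falling (fromℕ m * (x - fromℕ j) + r) s k

      summand : ∀ j k i → w j * (B k * (F j k * w′ j k i)) ≈ term l n j k i * basis (j ℕ.+ i)
      summand j k i = trans (rearrange _ _ _ _ _ _ _ _) (*-congˡ (sym (basis-+ j i)))

      inner : ∀ j k → w j * (B k * (F j k * G j k)) ≈ ∑[ i ≤ k ] (term l n j k i * basis (j ℕ.+ i))
      inner j k = begin
        w j * (B k * (F j k * G j k))
          -- The defining expansion is used here at the shifted point x - j, not at x.
          ≈⟨ *-congˡ (*-congˡ (*-congˡ (isWhitney k (x - fromℕ j)))) ⟩
        w j * (B k * (F j k * ∑≤ k (w′ j k)))
          ≈⟨ *-congˡ (*-congˡ (*-distribˡ-∑ k (F j k) (w′ j k))) ⟩
        w j * (B k * (∑[ i ≤ k ] (F j k * w′ j k i)))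
          ≈⟨ *-congˡ (*-distribˡ-∑ k (B k) (λ i → F j k * w′ j k i)) ⟩
        w j * (∑[ i ≤ k ] (B k * (F j k * w′ j k i)))
          ≈⟨ *-distribˡ-∑ k (w j) (λ i → B k * (F j k * w′ j k i)) ⟩
        ∑[ i ≤ k ] (w j * (B k * (F j k * w′ j k i)))
          ≈⟨ ∑-cong k (λ i _ → summand j k i) ⟩
        ∑[ i ≤ k ] (term l n j k i * basis (j ℕ.+ i)) ∎

      outer : ∀ j → w j * rest ≈ ∑[ k ≤ n ] ∑[ i ≤ k ] (term l n j k i * basis (j ℕ.+ i))
      outer j = begin
        w j * rest
          -- The centre depends on `j`, hence the second factor is rewritten separately inside each
          -- term of the outer sum.
          ≈⟨ *-congˡ (falling-cong (recentre l j) refl n) ⟩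
        w j * falling ((fromℕ m * (x - fromℕ j) + r) + offset l j) s n
          ≈⟨ *-congˡ (vandermonde _ (offset l j) s n) ⟩
        w j * (∑[ k ≤ n ] (B k * (F j k * G j k)))
          ≈⟨ *-distribˡ-∑ n (w j) (λ k → B k * (F j k * G j k)) ⟩
        ∑[ k ≤ n ] (w j * (B k * (F j k * G j k)))
          ≈⟨ ∑-cong n (λ k _ → inner j k) ⟩
        ∑[ k ≤ n ] ∑[ i ≤ k ] (term l n j k i * basis (j ℕ.+ i)) ∎

    basis-expansions : ∀ l n →
      ∑[ p ≤ l ℕ.+ n ] (W (l ℕ.+ n) p * fromℕ m ^ p * falling x 1# p)
        ≈ ∑[ p ≤ l ℕ.+ n ] (collected l n p * fromℕ m ^ p * falling x 1# p)
    basis-expansions l n = begin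
      ∑[ p ≤ l ℕ.+ n ] (W (l ℕ.+ n) p * fromℕ m ^ p * falling x 1# p)
        ≈⟨ isWhitney (l ℕ.+ n) x ⟨
      falling (fromℕ m * x + r) s (l ℕ.+ n)
        ≈⟨ falling-expansion l n ⟩
      ∑[ j ≤ l ] ∑[ k ≤ n ] ∑[ i ≤ k ] (term l n j k i * basis (j ℕ.+ i))
        -- Taken over `R` itself, where scalar action is multiplication, this groups the triple sum
        -- by p = j + i.
        ≈⟨ expand (selfAlgebra R) l n basis ⟨
      ∑[ p ≤ l ℕ.+ n ] (collected l n p * basis p)
        ≈⟨ ∑-cong (l ℕ.+ n) (λ p _ → *-assoc (collected l n p) (fromℕ m ^ p) (falling x 1# p)) ⟨
      ∑[ p ≤ l ℕ.+ n ] (collected l n p * fromℕ m ^ p * falling x 1# p) ∎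

  -- Comparing the two expansions at the points x = `fromℕ q` identifies the coefficients of (x)_p,
  -- which still carry m^p; this power cancels because m is nonzero.
  whitney-addition : ∀ l n p → p ≤ l ℕ.+ n → W (l ℕ.+ n) p ≈ collected l n p
  whitney-addition l n p p≤ = ^-cancel cancel m p _ _
    (trans (*-comm _ _) (trans
      (falling-independent cancel (l ℕ.+ n) (λ i → W (l ℕ.+ n) i * fromℕ m ^ i)
        (λ i → collected l n i * fromℕ m ^ i)
        (λ q → basis-expansions (fromℕ q) l n) p p≤)
      (*-comm _ _)))

  -- From coefficients to Dowling polynomials at an algebra element.

  module _ (A : Algebra R a ℓᵃ) (y : Algebra.Carrier A) where

    private
      module A = Algebra A
      module AΣ = BoundedSums A.semiring
      D = dowling A W
    open Scalars A
    open SetoidReasoning A.setoid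

    -- Scalars move to the front by centrality, and only powers of the one element `y` are
    -- multiplied, so y^j y^i = y^(j+i) holds without commutativity.
    ∑-term : ∀ l n j k →
      (fromℕ (n C k) * W l j) A.· (y A.^ j A.* (falling (offset l j) s (n ∸ k) A.· D k y))
        A.≈ A.∑≤ k (λ i → term l n j k i A.· y A.^ (j ℕ.+ i))
    ∑-term l n j k = begin
      u A.· (y A.^ j A.* (v A.· A.∑≤ k d))
        ≈⟨ A.*-congˡ (·-*-comm v (y A.^ j) (D k y)) ⟩
      u A.· v A.· (y A.^ j A.* A.∑≤ k d)
        ≈⟨ *-· u v _ ⟨
      (u * v) A.· (y A.^ j A.* A.∑≤ k d)
        ≈⟨ A.*-congˡ (AΣ.*-distribˡ-∑ k (y A.^ j) d) ⟩
      (u * v) A.· A.∑≤ k (λ i → y A.^ j A.* d i)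
        ≈⟨ AΣ.*-distribˡ-∑ k (A.ι (u * v)) (λ i → y A.^ j A.* d i) ⟩
      A.∑≤ k (λ i → (u * v) A.· (y A.^ j A.* d i))
        ≈⟨ AΣ.∑-cong k (λ i _ → summand i) ⟩
      A.∑≤ k (λ i → term l n j k i A.· y A.^ (j ℕ.+ i)) ∎
      where
      u v : Carrier
      u = fromℕ (n C k) * W l j
      v = falling (offset l j) s (n ∸ k)

      d : ℕ → A.Carrier
      d i = W k i A.· y A.^ i

      summand : ∀ i → (u * v) A.· (y A.^ j A.* d i) A.≈ term l n j k i A.· y A.^ (j ℕ.+ i)
      summand i = begin
        (u * v) A.· (y A.^ j A.* d i)                   ≈⟨ A.*-congˡ (·-*-comm (W k i) _ _) ⟩
        (u * v) A.· (W k i A.· (y A.^ j A.* y A.^ i))   ≈⟨ *-· (u * v) (W k i) _ ⟨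
        (u * v * W k i) A.· (y A.^ j A.* y A.^ i)
          ≈⟨ ·-cong (*-assoc u v (W k i)) (A.sym (Exp.^-homo-* A.semiring y j i)) ⟩
        term l n j k i A.· y A.^ (j ℕ.+ i)              ∎

    dowling-addition : ∀ l n →
      D (l ℕ.+ n) y A.≈ A.∑≤ l λ j → A.∑≤ n λ k →
        (fromℕ (n C k) * W l j) A.· (y A.^ j A.* (falling (offset l j) s (n ∸ k) A.· D k y))
    dowling-addition l n = begin
      A.∑≤ (l ℕ.+ n) (λ p → W (l ℕ.+ n) p A.· y A.^ p)
        ≈⟨ AΣ.∑-cong (l ℕ.+ n) (λ p p≤ → ·-congʳ (y A.^ p) (whitney-addition l n p p≤)) ⟩
      A.∑≤ (l ℕ.+ n) (λ p → collected l n p A.· y A.^ p)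
        ≈⟨ expand A l n (y A.^_) ⟩
      (A.∑≤ l λ j → A.∑≤ n λ k → A.∑≤ k λ i → term l n j k i A.· y A.^ (j ℕ.+ i))
        ≈⟨ AΣ.∑-cong l (λ j _ → AΣ.∑-cong n (λ k _ → ∑-term l n j k)) ⟨
      (A.∑≤ l λ j → A.∑≤ n λ k →
        (fromℕ (n C k) * W l j) A.· (y A.^ j A.* (falling (offset l j) s (n ∸ k) A.· D k y))) ∎

open Defs using (fromℕ; falling; IsWhitney)

-- Cancellation of positive integers in the Cauchy reals.

ℚ-fromℕ : ℕ → ℚ
ℚ-fromℕ zero    = 0ℚ
ℚ-fromℕ (suc n) = 1ℚ ℚ.+ ℚ-fromℕ n

ℚ-fromℕ≥0 : ∀ n → 0ℚ ℚ.≤ ℚ-fromℕ n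
ℚ-fromℕ≥0 zero    = ℚ.≤-refl
ℚ-fromℕ≥0 (suc n) = ℚ.+-mono-≤ (ℚ.<⇒≤ (ℚ.positive⁻¹ 1ℚ)) (ℚ-fromℕ≥0 n)

ℚ-fromℕ-suc>0 : ∀ n → 0ℚ ℚ.< ℚ-fromℕ (suc n)
ℚ-fromℕ-suc>0 n = ℚ.+-mono-<-≤ (ℚ.positive⁻¹ 1ℚ) (ℚ-fromℕ≥0 n)

seq-fromℕ : ∀ n i → Real.seq (fromℕ n) i ≡ ℚ-fromℕ n
seq-fromℕ zero    i = ≡.refl
seq-fromℕ (suc n) i = ≡.cong (1ℚ ℚ.+_) (seq-fromℕ n i)

constant⇒≈fromℚ : ∀ x q → (∀ i → Real.seq x i ≡ q) → x ≈ᴿ Real.fromℚ q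
constant⇒≈fromℚ x q x≡q = Real.mk≈ λ ε ε>0 → 0 , λ i j _ _ →
  ≡.subst (λ z → ℚ.∣ z ℚ.- q ∣ ℚ.< ε) (≡.sym (x≡q i))
    (≡.subst (λ z → ℚ.∣ z ∣ ℚ.< ε) (≡.sym (ℚ.+-inverseʳ q)) ε>0)

-- The witness is the constant sequence 1/n; multiplied by the constant sequence n it is 1 at every
-- index, so no general inversion of reals is involved.
fromℕ-inverse : ∀ n .{{_ : NonZero n}} → ∃[ y ] y *ᴿ fromℕ n ≈ᴿ 1ᴿ
fromℕ-inverse (suc n) = Real.fromℚ (ℚ.1/ q) , constant⇒≈fromℚ _ 1ℚ λ i →
  ≡.trans (≡.cong ((ℚ.1/ q) ℚ.*_) (seq-fromℕ (suc n) i)) (ℚ.*-inverseˡ q)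
  where
  q : ℚ
  q = ℚ-fromℕ (suc n)
  instance
    q≢0 : ℚ.NonZero q
    q≢0 = ℚ.>-nonZero (ℚ-fromℕ-suc>0 n)

fromℕ-cancel : FallingFactorials.Cancellable ℝ-commutativeRing
fromℕ-cancel n y z e with fromℕ-inverse n
... | n⁻¹ , n⁻¹*n≈1 = begin
  y                        ≈⟨ *-identityˡ y ⟨
  1ᴿ *ᴿ y                  ≈⟨ *-congʳ n⁻¹*n≈1 ⟨
  (n⁻¹ *ᴿ fromℕ n) *ᴿ y    ≈⟨ *-assoc n⁻¹ (fromℕ n) y ⟩
  n⁻¹ *ᴿ (fromℕ n *ᴿ y)    ≈⟨ *-congˡ e ⟩
  n⁻¹ *ᴿ (fromℕ n *ᴿ z)    ≈⟨ *-assoc n⁻¹ (fromℕ n) z ⟨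
  (n⁻¹ *ᴿ fromℕ n) *ᴿ z    ≈⟨ *-congʳ n⁻¹*n≈1 ⟩
  1ᴿ *ᴿ z                  ≈⟨ *-identityˡ z ⟩
  z                        ∎
  where
  open CommutativeRing ℝ-commutativeRing
  open SetoidReasoning setoid

-- The polynomial identity and its boson operator form.

theorem3p2 :
  ∀ {a ℓ} (m : ℕ) .{{_ : NonZero m}} (r λ′ : ℝ) → 0ᴿ ≤ᴿ r → ¬ (λ′ ≈ᴿ 0ᴿ) →
  (W : ℕ → ℕ → ℝ) → IsWhitney m r λ′ W →
  (l n : ℕ) →
  ( let open Algebra ℝ[X]
        D = dowling ℝ[X] W
    in D (l ℕ.+ n) X
         ≈ ∑[ j ≤ l ] ∑[ k ≤ n ]
             ( (fromℕ (n C k) *ᴿ W l j)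
               · (X ^ j * (falling (fromℕ m *ᴿ fromℕ j -ᴿ fromℕ l *ᴿ λ′) λ′ (n ∸ k) · D k X)) ) )
  ×
  ( (B : BosonAlgebra a ℓ) →
    let open BosonAlgebra B renaming (creation to a⁺)
        D = dowling algebra W
    in D (l ℕ.+ n) (fromℕ m · a⁺)
         ≈ ∑[ j ≤ l ] ∑[ k ≤ n ]
             ( (fromℕ (n C k) *ᴿ W l j *ᴿ fromℕ m ^ᴿ j)
               · (a⁺ ^ j * (falling (fromℕ m *ᴿ fromℕ j -ᴿ fromℕ l *ᴿ λ′) λ′ (n ∸ k) · D k (fromℕ m · a⁺))) ) )
theorem3p2 {a} {ℓ} m r λ′ _ _ W isWhitney l n = dowling-addition ℝ[X] X l n , boson
  where
  open DowlingAddition ℝ-commutativeRing fromℕ-cancel m r λ′ W isWhitney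

  boson : (B : BosonAlgebra a ℓ) →
    let open BosonAlgebra B renaming (creation to a⁺)
        D = dowling algebra W
    in D (l ℕ.+ n) (fromℕ m · a⁺)
         ≈ ∑[ j ≤ l ] ∑[ k ≤ n ]
             ( (fromℕ (n C k) *ᴿ W l j *ᴿ fromℕ m ^ᴿ j)
               · (a⁺ ^ j * (falling (offset l j) λ′ (n ∸ k) · D k (fromℕ m · a⁺))) )
  -- The formula at y = m a⁺ contains (m a⁺)^j; extracting the central scalar m^j and merging it
  -- with the coefficient gives the stated form.
  boson B = trans (dowling-addition algebra (fromℕ m · a⁺) l n)
    (∑-cong l (λ j _ → ∑-cong n (λ k _ → begin
      (fromℕ (n C k) *ᴿ W l j) · ((fromℕ m · a⁺) ^ j * G j k)
        ≈⟨ *-congˡ (*-congʳ (·-^ (fromℕ m) a⁺ j)) ⟩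
      (fromℕ (n C k) *ᴿ W l j) · (((fromℕ m ^ᴿ j) · a⁺ ^ j) * G j k)
        ≈⟨ *-congˡ (*-assoc _ _ _) ⟩
      (fromℕ (n C k) *ᴿ W l j) · (fromℕ m ^ᴿ j) · (a⁺ ^ j * G j k)
        ≈⟨ *-· (fromℕ (n C k) *ᴿ W l j) (fromℕ m ^ᴿ j) _ ⟨
      (fromℕ (n C k) *ᴿ W l j *ᴿ fromℕ m ^ᴿ j) · (a⁺ ^ j * G j k) ∎)))
    where
    open BosonAlgebra B renaming (creation to a⁺)
    open Scalars algebra
    open BoundedSums semiring
    open SetoidReasoning setoid
    G : (j k : ℕ) → Carrier
    G j k = falling (offset l j) λ′ (n ∸ k) · dowling algebra W k (fromℕ m · a⁺)
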